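{- Let $(X,d_X)$ and $(Y,d_Y)$ be metric spaces. Suppose that every finite subset of $X$ is similarly embedded into $Y$, and vice versa (every finite subset of $Y$ is similarly embedded into $X$). Then $\operatorname{UBG}(X)=\operatorname{UBG}(Y)$.
   Context: All graphs are finite, simple and undirected. A finite subset $S\subseteq X$ is similarly embedded into $Y$ if there exist $r>0$ and a map $f\colon S\to Y$ such that $d_Y(f(a),f(b))=r\,d_X(a,b)$ for all $a,b\in S$ ($r$ and $f$ may depend on $S$). A graph $G=(V_G,E_G)$ is a unit ball graph on a metric space $(X,d)$ if there exist $\delta>0$ and a map $\rho\colon V_G\to X$ such that for distinct $u,v\in V_G$, $\{u,v\}\in E_G$ if and only if $d(\rho(u),\rho(v))\le\delta$. $\operatorname{UBG}(X)$ denotes the collection of all unit ball graphs on $X$. -}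

module Defs where

open import Data.Fin.Base using (Fin)
open import Data.List.Base using (List)
import Data.List.Membership.Setoid as Membership
open import Data.Nat.Base as ℕ using (ℕ)
import Data.Nat.Properties as ℕ
open import Data.Product.Base using (∃-syntax; Σ-syntax; _×_; _,_; proj₁)
open import Data.Rational.Base as ℚ using (ℚ; 0ℚ; 1ℚ; ½; ∣_∣)
import Data.Rational.Properties as ℚ
open import Data.Rational.Solver using (module +-*-Solver)
open import Data.Sum.Base using (inj₁; inj₂)
open import Function.Bundles using (_⇔_; _↔_)
open import Function.Metric.Core using (DistanceFunction)
import Function.Metric.Structures as Metric
open import Level using (Level; suc; _⊔_)
open import Relation.Binary.Bundles using (Setoid)
open import Relation.Binary.Core using (Rel)
open import Relation.Binary.Definitions using (Symmetric; Irreflexive)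
open import Relation.Binary.PropositionalEquality
  using (_≡_; _≢_; refl; sym; trans; cong; subst; module ≡-Reasoning)
open import Relation.Binary.Structures using (IsEquivalence; IsPartialOrder)
open import Relation.Unary using (Pred)

private
  variable
    a b ℓ ℓ₁ ℓ₂ v e : Level

-- The reals are Cauchy sequences of rationals, with the equality that
-- identifies two sequences when their difference tends to 0.

Eventually : Pred (Pred ℕ ℓ) ℓ
Eventually P = ∃[ N ] (∀ n → N ℕ.≤ n → P n)

IsCauchy : (ℕ → ℚ) → Set
IsCauchy x = ∀ ε → 0ℚ ℚ.< ε →
  ∃[ N ] (∀ m n → N ℕ.≤ m → N ℕ.≤ n → ∣ x m ℚ.- x n ∣ ℚ.≤ ε)

record ℝ : Set where
  constructor mkℝ
  field
    seq    : ℕ → ℚ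
    cauchy : IsCauchy seq

open ℝ public

infix 4 _≃_ _≤_ _<_

_≃_ : Rel ℝ _
x ≃ y = ∀ ε → 0ℚ ℚ.< ε → Eventually (λ n → ∣ seq x n ℚ.- seq y n ∣ ℚ.≤ ε)

_≤_ : Rel ℝ _
x ≤ y = ∀ ε → 0ℚ ℚ.< ε → Eventually (λ n → seq x n ℚ.≤ seq y n ℚ.+ ε)

-- The gap ε must be uniform in n: eventual termwise strict inequality
-- would not separate the limits.
_<_ : Rel ℝ _
x < y = ∃[ ε ] (0ℚ ℚ.< ε × Eventually (λ n → seq x n ℚ.+ ε ℚ.≤ seq y n))

-- The Cauchy proofs for sums and products are abstract: they carry no
-- content beyond their types, and unfolding them is expensive.
private
  half-pos : ∀ {ε} → 0ℚ ℚ.< ε → 0ℚ ℚ.< ½ ℚ.* ε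
  half-pos {ε} 0<ε = ℚ.positive⁻¹ _
    {{ℚ.pos*pos⇒pos ½ ε {{ℚ.positive 0<ε}}}}

  halves : ∀ ε → ½ ℚ.* ε ℚ.+ ½ ℚ.* ε ≡ ε
  halves ε = begin
    ½ ℚ.* ε ℚ.+ ½ ℚ.* ε  ≡⟨ ℚ.*-distribʳ-+ ε ½ ½ ⟨
    1ℚ ℚ.* ε             ≡⟨ ℚ.*-identityˡ ε ⟩
    ε                    ∎
    where open ≡-Reasoning

  abstract
    +-cauchy : ∀ {x y} → IsCauchy x → IsCauchy y → IsCauchy (λ n → x n ℚ.+ y n)
    +-cauchy {x} {y} cx cy ε 0<ε
      with cx (½ ℚ.* ε) (half-pos 0<ε) | cy (½ ℚ.* ε) (half-pos 0<ε)
    ... | M , hx | N , hy = M ℕ.⊔ N , λ m n p q → begin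
      ∣ (x m ℚ.+ y m) ℚ.- (x n ℚ.+ y n) ∣
        ≡⟨ cong ∣_∣ (rearrange (x m) (y m) (x n) (y n)) ⟩
      ∣ (x m ℚ.- x n) ℚ.+ (y m ℚ.- y n) ∣
        ≤⟨ ℚ.∣p+q∣≤∣p∣+∣q∣ (x m ℚ.- x n) (y m ℚ.- y n) ⟩
      ∣ x m ℚ.- x n ∣ ℚ.+ ∣ y m ℚ.- y n ∣
        ≤⟨ ℚ.+-mono-≤ (hx m n (ℕ.m⊔n≤o⇒m≤o M N p) (ℕ.m⊔n≤o⇒m≤o M N q))
                      (hy m n (ℕ.m⊔n≤o⇒n≤o M N p) (ℕ.m⊔n≤o⇒n≤o M N q)) ⟩
      ½ ℚ.* ε ℚ.+ ½ ℚ.* ε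
        ≡⟨ halves ε ⟩
      ε ∎
      where
      open ℚ.≤-Reasoning
      open +-*-Solver
      rearrange : ∀ p q r s → (p ℚ.+ q) ℚ.- (r ℚ.+ s) ≡ (p ℚ.- r) ℚ.+ (q ℚ.- s)
      rearrange = solve 4
        (λ p q r s → (p :+ q) :- (r :+ s) := (p :- r) :+ (q :- s)) refl

  bounded : ∀ {x} → IsCauchy x →
            ∃[ B ] (0ℚ ℚ.< B × Eventually (λ n → ∣ x n ∣ ℚ.≤ B))
  bounded {x} cx with cx 1ℚ (ℚ.positive⁻¹ 1ℚ)
  ... | N , h = 1ℚ ℚ.+ ∣ x N ∣
              , ℚ.+-mono-<-≤ (ℚ.positive⁻¹ 1ℚ) (ℚ.0≤∣p∣ (x N))
              , N , λ n N≤n → begin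
    ∣ x n ∣                          ≡⟨ cong ∣_∣ (rearrange (x n) (x N)) ⟩
    ∣ (x n ℚ.- x N) ℚ.+ x N ∣        ≤⟨ ℚ.∣p+q∣≤∣p∣+∣q∣ (x n ℚ.- x N) (x N) ⟩
    ∣ x n ℚ.- x N ∣ ℚ.+ ∣ x N ∣      ≤⟨ ℚ.+-monoˡ-≤ ∣ x N ∣ (h n N N≤n ℕ.≤-refl) ⟩
    1ℚ ℚ.+ ∣ x N ∣                   ∎
    where
    open ℚ.≤-Reasoning
    open +-*-Solver
    rearrange : ∀ p q → p ≡ (p ℚ.- q) ℚ.+ q
    rearrange = solve 2 (λ p q → p := (p :- q) :+ q) refl

  *-mono-∣∣ : ∀ {p q r s} → ∣ p ∣ ℚ.≤ r → ∣ q ∣ ℚ.≤ s → ∣ p ℚ.* q ∣ ℚ.≤ r ℚ.* s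
  *-mono-∣∣ {p} {q} {r} {s} p≤r q≤s = begin
    ∣ p ℚ.* q ∣      ≡⟨ ℚ.∣p*q∣≡∣p∣*∣q∣ p q ⟩
    ∣ p ∣ ℚ.* ∣ q ∣  ≤⟨ ℚ.*-monoʳ-≤-nonNeg ∣ q ∣ {{ℚ.∣-∣-nonNeg q}} p≤r ⟩
    r ℚ.* ∣ q ∣      ≤⟨ ℚ.*-monoˡ-≤-nonNeg r
                          {{ℚ.nonNegative (ℚ.≤-trans (ℚ.0≤∣p∣ p) p≤r)}} q≤s ⟩
    r ℚ.* s          ∎
    where open ℚ.≤-Reasoning

  *-step : ∀ p q r s {B C η} →
           ∣ p ∣ ℚ.≤ B → ∣ q ℚ.- s ∣ ℚ.≤ η → ∣ p ℚ.- r ∣ ℚ.≤ η → ∣ s ∣ ℚ.≤ C →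
           ∣ p ℚ.* q ℚ.- r ℚ.* s ∣ ℚ.≤ (B ℚ.+ C) ℚ.* η
  *-step p q r s {B} {C} {η} p≤B q-s≤η p-r≤η s≤C = begin
    ∣ p ℚ.* q ℚ.- r ℚ.* s ∣
      ≡⟨ cong ∣_∣ (rearrange p q r s) ⟩
    ∣ p ℚ.* (q ℚ.- s) ℚ.+ (p ℚ.- r) ℚ.* s ∣
      ≤⟨ ℚ.∣p+q∣≤∣p∣+∣q∣ (p ℚ.* (q ℚ.- s)) ((p ℚ.- r) ℚ.* s) ⟩
    ∣ p ℚ.* (q ℚ.- s) ∣ ℚ.+ ∣ (p ℚ.- r) ℚ.* s ∣
      ≤⟨ ℚ.+-mono-≤ (*-mono-∣∣ {p} {q ℚ.- s} p≤B q-s≤η)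
                    (*-mono-∣∣ {p ℚ.- r} {s} p-r≤η s≤C) ⟩
    B ℚ.* η ℚ.+ η ℚ.* C
      ≡⟨ cong (B ℚ.* η ℚ.+_) (ℚ.*-comm η C) ⟩
    B ℚ.* η ℚ.+ C ℚ.* η
      ≡⟨ ℚ.*-distribʳ-+ η B C ⟨
    (B ℚ.+ C) ℚ.* η ∎
    where
    open ℚ.≤-Reasoning
    open +-*-Solver
    rearrange : ∀ p q r s → p ℚ.* q ℚ.- r ℚ.* s ≡ p ℚ.* (q ℚ.- s) ℚ.+ (p ℚ.- r) ℚ.* s
    rearrange = solve 4
      (λ p q r s → p :* q :- r :* s := p :* (q :- s) :+ (p :- r) :* s) refl

  quotient : ∀ D ε → 0ℚ ℚ.< D → 0ℚ ℚ.< ε → ∃[ η ] (0ℚ ℚ.< η × D ℚ.* η ≡ ε)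
  quotient D ε 0<D 0<ε = D⁻¹ ℚ.* ε , ℚ.positive⁻¹ (D⁻¹ ℚ.* ε) {{D⁻¹ε-pos}} , (begin
    D ℚ.* (D⁻¹ ℚ.* ε)  ≡⟨ ℚ.*-assoc D D⁻¹ ε ⟨
    D ℚ.* D⁻¹ ℚ.* ε    ≡⟨ cong (ℚ._* ε) (ℚ.*-inverseʳ D) ⟩
    1ℚ ℚ.* ε           ≡⟨ ℚ.*-identityˡ ε ⟩
    ε                  ∎)
    where
    open ≡-Reasoning
    instance
      D-pos : ℚ.Positive D
      D-pos = ℚ.positive 0<D
      D-nonZero : ℚ.NonZero D
      D-nonZero = ℚ.pos⇒nonZero D
    D⁻¹ : ℚ
    D⁻¹ = ℚ.1/ D
    D⁻¹ε-pos : ℚ.Positive (D⁻¹ ℚ.* ε)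
    D⁻¹ε-pos = ℚ.pos*pos⇒pos D⁻¹ {{ℚ.1/pos⇒pos D}} ε {{ℚ.positive 0<ε}}

  abstract
    *-cauchy : ∀ {x y} → IsCauchy x → IsCauchy y → IsCauchy (λ n → x n ℚ.* y n)
    *-cauchy {x} {y} cx cy ε 0<ε =
      let B , 0<B , K , bx = bounded {x} cx
          C , 0<C , L , by = bounded {y} cy
          η , 0<η , Dη≡ε   = quotient (B ℚ.+ C) ε (ℚ.+-mono-< {0ℚ} {B} {0ℚ} {C} 0<B 0<C) 0<ε
          M , hx           = cx η 0<η
          N , hy           = cy η 0<η
      in (M ℕ.⊔ N) ℕ.⊔ (K ℕ.⊔ L) , λ m n p q →
      let p₁ = ℕ.m⊔n≤o⇒m≤o (M ℕ.⊔ N) (K ℕ.⊔ L) p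
          q₁ = ℕ.m⊔n≤o⇒m≤o (M ℕ.⊔ N) (K ℕ.⊔ L) q
          p₂ = ℕ.m⊔n≤o⇒n≤o (M ℕ.⊔ N) (K ℕ.⊔ L) p
          q₂ = ℕ.m⊔n≤o⇒n≤o (M ℕ.⊔ N) (K ℕ.⊔ L) q
      in ℚ.≤-trans
           (*-step (x m) (y m) (x n) (y n) {B} {C} {η}
             (bx m (ℕ.m⊔n≤o⇒m≤o K L p₂))
             (hy m n (ℕ.m⊔n≤o⇒n≤o M N p₁) (ℕ.m⊔n≤o⇒n≤o M N q₁))
             (hx m n (ℕ.m⊔n≤o⇒m≤o M N p₁) (ℕ.m⊔n≤o⇒m≤o M N q₁))
             (by n (ℕ.m⊔n≤o⇒n≤o K L q₂)))
           (ℚ.≤-reflexive Dη≡ε)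

infixl 6 _+_
infixl 7 _*_

_+_ : ℝ → ℝ → ℝ
x + y = mkℝ (λ n → seq x n ℚ.+ seq y n) (+-cauchy {seq x} {seq y} (cauchy x) (cauchy y))

_*_ : ℝ → ℝ → ℝ
x * y = mkℝ (λ n → seq x n ℚ.* seq y n) (*-cauchy {seq x} {seq y} (cauchy x) (cauchy y))

0ℝ : ℝ
0ℝ = mkℝ (λ _ → 0ℚ) (λ ε 0<ε → 0 , λ _ _ _ _ → ℚ.<⇒≤ 0<ε)

-- _≤_ is a partial order with respect to _≃_. The library's metric
-- structures carry this as a field, so it is shown here that the field
-- imposes no condition on a metric.

private
  p≤∣p∣ : ∀ p → p ℚ.≤ ∣ p ∣
  p≤∣p∣ p with ℚ.≤-total 0ℚ p
  ... | inj₁ 0≤p = ℚ.≤-reflexive (sym (ℚ.0≤p⇒∣p∣≡p 0≤p))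
  ... | inj₂ p≤0 = ℚ.≤-trans p≤0 (ℚ.0≤∣p∣ p)

  p≤q+r⇒p-q≤r : ∀ {p q r} → p ℚ.≤ q ℚ.+ r → p ℚ.- q ℚ.≤ r
  p≤q+r⇒p-q≤r {p} {q} {r} p≤q+r = begin
    p ℚ.- q          ≤⟨ ℚ.+-monoˡ-≤ (ℚ.- q) p≤q+r ⟩
    q ℚ.+ r ℚ.- q    ≡⟨ solve 2 (λ q r → q :+ r :- q := r) refl q r ⟩
    r                ∎
    where
    open ℚ.≤-Reasoning
    open +-*-Solver

  neg-sub : ∀ p q → ℚ.- (p ℚ.- q) ≡ q ℚ.- p
  neg-sub = solve 2 (λ p q → :- (p :- q) := q :- p) refl
    where open +-*-Solver

  ≃⇒≤ : ∀ {x y} → x ≃ y → x ≤ y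
  ≃⇒≤ {x} {y} x≃y ε 0<ε with x≃y ε 0<ε
  ... | N , h = N , λ n N≤n → begin
    seq x n                              ≡⟨ rearrange (seq x n) (seq y n) ⟩
    seq y n ℚ.+ (seq x n ℚ.- seq y n)    ≤⟨ ℚ.+-monoʳ-≤ (seq y n) (ℚ.≤-trans (p≤∣p∣ _) (h n N≤n)) ⟩
    seq y n ℚ.+ ε                        ∎
    where
    open ℚ.≤-Reasoning
    open +-*-Solver
    rearrange : ∀ p q → p ≡ q ℚ.+ (p ℚ.- q)
    rearrange = solve 2 (λ p q → p := q :+ (p :- q)) refl

  ≤-antisym : ∀ {x y} → x ≤ y → y ≤ x → x ≃ y
  ≤-antisym {x} {y} x≤y y≤x ε 0<ε with x≤y ε 0<ε | y≤x ε 0<ε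
  ... | M , h | N , k = M ℕ.⊔ N , λ n q → bound n
        (p≤q+r⇒p-q≤r (h n (ℕ.m⊔n≤o⇒m≤o M N q)))
        (p≤q+r⇒p-q≤r (k n (ℕ.m⊔n≤o⇒n≤o M N q)))
    where
    bound : ∀ n → seq x n ℚ.- seq y n ℚ.≤ ε → seq y n ℚ.- seq x n ℚ.≤ ε →
            ∣ seq x n ℚ.- seq y n ∣ ℚ.≤ ε
    bound n p q with ℚ.∣p∣≡p∨∣p∣≡-p (seq x n ℚ.- seq y n)
    ... | inj₁ eq = subst (ℚ._≤ ε) (sym eq) p
    ... | inj₂ eq = subst (ℚ._≤ ε) (sym (trans eq (neg-sub (seq x n) (seq y n)))) q

  ≤-trans : ∀ {x y z} → x ≤ y → y ≤ z → x ≤ z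
  ≤-trans {x} {y} {z} x≤y y≤z ε 0<ε
    with x≤y (½ ℚ.* ε) (half-pos 0<ε) | y≤z (½ ℚ.* ε) (half-pos 0<ε)
  ... | M , h | N , k = M ℕ.⊔ N , λ n q → begin
    seq x n                                    ≤⟨ h n (ℕ.m⊔n≤o⇒m≤o M N q) ⟩
    seq y n ℚ.+ ½ ℚ.* ε                        ≤⟨ ℚ.+-monoˡ-≤ (½ ℚ.* ε) (k n (ℕ.m⊔n≤o⇒n≤o M N q)) ⟩
    seq z n ℚ.+ ½ ℚ.* ε ℚ.+ ½ ℚ.* ε            ≡⟨ ℚ.+-assoc (seq z n) (½ ℚ.* ε) (½ ℚ.* ε) ⟩
    seq z n ℚ.+ (½ ℚ.* ε ℚ.+ ½ ℚ.* ε)          ≡⟨ cong (seq z n ℚ.+_) (halves ε) ⟩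
    seq z n ℚ.+ ε                              ∎
    where open ℚ.≤-Reasoning

  ≃-refl : ∀ {x} → x ≃ x
  ≃-refl {x} ε 0<ε = 0 , λ n _ →
    subst (λ p → ∣ p ∣ ℚ.≤ ε) (sym (ℚ.+-inverseʳ (seq x n))) (ℚ.<⇒≤ 0<ε)

  ≃-sym : ∀ {x y} → x ≃ y → y ≃ x
  ≃-sym {x} {y} x≃y ε 0<ε with x≃y ε 0<ε
  ... | N , h = N , λ n N≤n → subst (ℚ._≤ ε) (flip-∣∣ (seq x n) (seq y n)) (h n N≤n)
    where
    flip-∣∣ : ∀ p q → ∣ p ℚ.- q ∣ ≡ ∣ q ℚ.- p ∣
    flip-∣∣ p q = trans (sym (ℚ.∣-p∣≡∣p∣ (p ℚ.- q))) (cong ∣_∣ (neg-sub p q))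

  ≃-trans : ∀ {x y z} → x ≃ y → y ≃ z → x ≃ z
  ≃-trans {x} {y} {z} x≃y y≃z = ≤-antisym {x} {z}
    (≤-trans {x} {y} {z} (≃⇒≤ {x} {y} x≃y) (≃⇒≤ {y} {z} y≃z))
    (≤-trans {z} {y} {x} (≃⇒≤ {z} {y} (≃-sym {y} {z} y≃z)) (≃⇒≤ {y} {x} (≃-sym {x} {y} x≃y)))

≃-isEquivalence : IsEquivalence _≃_
≃-isEquivalence = record
  { refl  = λ {x} → ≃-refl {x}
  ; sym   = λ {x} {y} → ≃-sym {x} {y}
  ; trans = λ {x} {y} {z} → ≃-trans {x} {y} {z}
  }

≤-isPartialOrder : IsPartialOrder _≃_ _≤_
≤-isPartialOrder = record
  { isPreorder = record
    { isEquivalence = ≃-isEquivalence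
    ; reflexive     = λ {x} {y} → ≃⇒≤ {x} {y}
    ; trans         = λ {x} {y} {z} → ≤-trans {x} {y} {z}
    }
  ; antisym = λ {x} {y} → ≤-antisym {x} {y}
  }

record MetricSpace a ℓ : Set (suc (a ⊔ ℓ)) where
  infix 4 _≈_
  field
    Carrier  : Set a
    _≈_      : Rel Carrier ℓ
    d        : DistanceFunction Carrier ℝ
    isMetric : Metric.IsGeneralMetric _≈_ _≃_ _≤_ 0ℝ _+_ d

  open Metric.IsGeneralMetric isMetric public using (≈-isEquivalence)

  setoid : Setoid a ℓ
  setoid = record { isEquivalence = ≈-isEquivalence }

-- A finite subset is given by a list enumerating it, possibly with
-- repetitions; its elements are the points of X that are _≈_ to an entry.
module _ (X : MetricSpace a ℓ) where
  private module X = MetricSpace X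

  FiniteSubset : Set a
  FiniteSubset = List X.Carrier

  Elements : FiniteSubset → Set (a ⊔ ℓ)
  Elements S = ∃[ x ] x ∈ S
    where open Membership X.setoid using (_∈_)

-- f automatically respects the equalities of X and Y: equal points are
-- those at distance 0, and f sends distance 0 to distance 0.
SimilarlyEmbedded : (X : MetricSpace a ℓ₁) (Y : MetricSpace b ℓ₂) →
                    FiniteSubset X → Set (a ⊔ ℓ₁ ⊔ b)
SimilarlyEmbedded X Y S =
  ∃[ r ] (0ℝ < r ×
    Σ[ f ∈ (Elements X S → Y.Carrier) ] (∀ s t →
      Y.d (f s) (f t) ≃ r * X.d (proj₁ s) (proj₁ t)))
  where
  module X = MetricSpace X
  module Y = MetricSpace Y

-- Adjacency is not required to be decidable, so that every classical
-- finite simple graph is included without an appeal to excluded middle.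
record Graph v e : Set (suc (v ⊔ e)) where
  field
    V           : Set v
    E           : Rel V e
    order       : ℕ
    enumeration : V ↔ Fin order
    symmetric   : Symmetric E
    irreflexive : Irreflexive _≡_ E

IsUnitBallGraph : MetricSpace a ℓ → Graph v e → Set (a ⊔ v ⊔ e)
IsUnitBallGraph X G =
  ∃[ δ ] (0ℝ < δ ×
    Σ[ ρ ∈ (V → X.Carrier) ] (∀ u w → u ≢ w → E u w ⇔ X.d (ρ u) (ρ w) ≤ δ))
  where
  open Graph G using (V; E)
  module X = MetricSpace X

UBG : MetricSpace a ℓ → Pred (Graph v e) (a ⊔ v ⊔ e)
UBG = IsUnitBallGraph

{-# OPTIONS --safe #-}
-- A unit ball realization (δ , ρ) in X only involves the finite set ρ(V). If
-- f embeds that set into Y with scale r > 0, then (r δ , f ∘ ρ) is a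
-- realization in Y, because multiplication by r preserves and reflects ≤.

module Submission where

open import Data.List.Base using (tabulate)
import Data.List.Membership.Setoid as Membership
import Data.List.Membership.Setoid.Properties as Membershipₚ
open import Data.Nat.Base as ℕ using (ℕ)
import Data.Nat.Properties as ℕ
open import Data.Product.Base using (∃-syntax; _×_; _,_)
open import Data.Rational.Base as ℚ using (ℚ; 0ℚ; 1ℚ; ∣_∣)
import Data.Rational.Properties as ℚ
open import Data.Rational.Solver using (module +-*-Solver)
open import Defs using (MetricSpace; FiniteSubset; SimilarlyEmbedded; Graph; UBG)
open import Defs using (Elements; Eventually; ℝ; seq; cauchy; 0ℝ; _≤_; _<_; _*_; ≤-isPartialOrder)
open import Function.Base using (_∘_)
open import Function.Bundles using (mk⇔; module Equivalence; module Inverse)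
open import Relation.Binary.PropositionalEquality using (_≡_; refl; cong; subst; module ≡-Reasoning)
open import Relation.Binary.Structures using (module IsPartialOrder)
open import Relation.Unary using (_⊆_; _≐_)

private
  module ≤ = IsPartialOrder ≤-isPartialOrder

  Eventually-map₂ : ∀ {p q r} {P : ℕ → Set p} {Q : ℕ → Set q} {R : ℕ → Set r} →
    (∀ {n} → P n → Q n → R n) → Eventually P → Eventually Q → Eventually R
  Eventually-map₂ f (M , h) (N , k) = M ℕ.⊔ N , λ n q →
    f (h n (ℕ.m⊔n≤o⇒m≤o M N q)) (k n (ℕ.m⊔n≤o⇒n≤o M N q))

  0<p*q : ∀ {p q} → 0ℚ ℚ.< p → 0ℚ ℚ.< q → 0ℚ ℚ.< p ℚ.* q
  0<p*q {p} {q} 0<p 0<q = ℚ.positive⁻¹ _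
    {{ℚ.pos*pos⇒pos p {{ℚ.positive 0<p}} q {{ℚ.positive 0<q}}}}

  -- Unfolding `0ℝ < x` leaves a summand `0ℚ` in the termwise bound; this removes it.
  0+p≤q⇒p≤q : ∀ p {q} → 0ℚ ℚ.+ p ℚ.≤ q → p ℚ.≤ q
  0+p≤q⇒p≤q p {q} = subst (ℚ._≤ q) (ℚ.+-identityˡ p)

  -- Abstract because with-abstraction would otherwise normalise these proofs.
  abstract
    quotient : ∀ p q → 0ℚ ℚ.< p → 0ℚ ℚ.< q → ∃[ r ] (0ℚ ℚ.< r × p ℚ.* r ≡ q)
    quotient p q 0<p 0<q = ℚ.1/ p ℚ.* q , 0<p*q {ℚ.1/ p} {q} (ℚ.positive⁻¹ _ {{ℚ.1/pos⇒pos p}}) 0<q , (begin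
      p ℚ.* (ℚ.1/ p ℚ.* q)    ≡⟨ ℚ.*-assoc p (ℚ.1/ p) q ⟨
      p ℚ.* ℚ.1/ p ℚ.* q      ≡⟨ cong (ℚ._* q) (ℚ.*-inverseʳ p) ⟩
      1ℚ ℚ.* q                ≡⟨ ℚ.*-identityˡ q ⟩
      q                       ∎)
      where
      open ≡-Reasoning
      instance
        p-pos : ℚ.Positive p
        p-pos = ℚ.positive 0<p
        p-nonZero : ℚ.NonZero p
        p-nonZero = ℚ.pos⇒nonZero p

    -- From the Cauchy threshold `N` for tolerance 1 on, every term lies within 1 of `seq x N`.
    bounded : ∀ x → ∃[ B ] (0ℚ ℚ.< B × Eventually (λ n → ∣ seq x n ∣ ℚ.≤ B))
    bounded x with cauchy x 1ℚ (ℚ.positive⁻¹ 1ℚ)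
    ... | N , h = 1ℚ ℚ.+ ∣ seq x N ∣
                , ℚ.+-mono-<-≤ (ℚ.positive⁻¹ 1ℚ) (ℚ.0≤∣p∣ (seq x N))
                , N , λ n N≤n → begin
      ∣ seq x n ∣                                ≡⟨ cong ∣_∣ (rearrange (seq x n) (seq x N)) ⟩
      ∣ (seq x n ℚ.- seq x N) ℚ.+ seq x N ∣      ≤⟨ ℚ.∣p+q∣≤∣p∣+∣q∣ (seq x n ℚ.- seq x N) (seq x N) ⟩
      ∣ seq x n ℚ.- seq x N ∣ ℚ.+ ∣ seq x N ∣    ≤⟨ ℚ.+-monoˡ-≤ ∣ seq x N ∣ (h n N N≤n ℕ.≤-refl) ⟩
      1ℚ ℚ.+ ∣ seq x N ∣                         ∎
      where
      open ℚ.≤-Reasoning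
      open +-*-Solver
      rearrange : ∀ p q → p ≡ (p ℚ.- q) ℚ.+ q
      rearrange = solve 2 (λ p q → p := (p :- q) :+ q) refl

-- The gaps `ε` and `η` are eventual lower bounds for the two sequences, so their product is one for
-- the product sequence.
*-pos : ∀ {x y} → 0ℝ < x → 0ℝ < y → 0ℝ < x * y
*-pos {x} {y} (ε , 0<ε , ε≤x) (η , 0<η , η≤y) =
  ε ℚ.* η , 0<p*q 0<ε 0<η , Eventually-map₂ (λ {n} → bound {n}) ε≤x η≤y
  where
  open ℚ.≤-Reasoning
  bound : ∀ {n} → 0ℚ ℚ.+ ε ℚ.≤ seq x n → 0ℚ ℚ.+ η ℚ.≤ seq y n →
          0ℚ ℚ.+ ε ℚ.* η ℚ.≤ seq x n ℚ.* seq y n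
  bound {n} p q = begin
    0ℚ ℚ.+ ε ℚ.* η        ≡⟨ ℚ.+-identityˡ (ε ℚ.* η) ⟩
    ε ℚ.* η               ≤⟨ ℚ.*-monoʳ-≤-nonNeg η {{ℚ.nonNegative (ℚ.<⇒≤ 0<η)}} ε≤xₙ ⟩
    seq x n ℚ.* η         ≤⟨ ℚ.*-monoˡ-≤-nonNeg (seq x n)
                              {{ℚ.nonNegative (ℚ.≤-trans (ℚ.<⇒≤ 0<ε) ε≤xₙ)}} (0+p≤q⇒p≤q η q) ⟩
    seq x n ℚ.* seq y n   ∎
    where
    ε≤xₙ : ε ℚ.≤ seq x n
    ε≤xₙ = 0+p≤q⇒p≤q ε p

private
  -- Termwise core of monotonicity: multiplying by `r` turns the slack `η` into `r η`, which is at
  -- most `B η = ε`.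
  *-monoˡ-≤-slack : ∀ {p q r B η ε} → 0ℚ ℚ.≤ r → r ℚ.≤ B → 0ℚ ℚ.≤ η → B ℚ.* η ≡ ε →
                    p ℚ.≤ q ℚ.+ η → r ℚ.* p ℚ.≤ r ℚ.* q ℚ.+ ε
  *-monoˡ-≤-slack {p} {q} {r} {B} {η} {ε} 0≤r r≤B 0≤η Bη≡ε p≤q+η = begin
    r ℚ.* p                ≤⟨ ℚ.*-monoˡ-≤-nonNeg r {{ℚ.nonNegative 0≤r}} p≤q+η ⟩
    r ℚ.* (q ℚ.+ η)        ≡⟨ ℚ.*-distribˡ-+ r q η ⟩
    r ℚ.* q ℚ.+ r ℚ.* η    ≤⟨ ℚ.+-monoʳ-≤ (r ℚ.* q) (ℚ.*-monoʳ-≤-nonNeg η {{ℚ.nonNegative 0≤η}} r≤B) ⟩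
    r ℚ.* q ℚ.+ B ℚ.* η    ≡⟨ cong (r ℚ.* q ℚ.+_) Bη≡ε ⟩
    r ℚ.* q ℚ.+ ε          ∎
    where open ℚ.≤-Reasoning

*-monoˡ-≤-pos : ∀ r {x y} → 0ℝ < r → x ≤ y → r * x ≤ r * y
*-monoˡ-≤-pos r {x} {y} (c , 0<c , L , c≤r) x≤y ε 0<ε with bounded r
-- The slack for `x ≤ y` must be chosen before `n`, so it is `ε / B` with an eventual bound `B` on
-- `r`, not `ε` divided by a term of `r`.
... | B , 0<B , M , r≤B with quotient B ε 0<B 0<ε
... | η , 0<η , Bη≡ε with x≤y η 0<η
... | N , x≤y+η = L ℕ.⊔ (M ℕ.⊔ N) , λ n q →
  let q′ = ℕ.m⊔n≤o⇒n≤o L (M ℕ.⊔ N) q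
      0≤rₙ = ℚ.≤-trans (ℚ.<⇒≤ 0<c) (0+p≤q⇒p≤q c (c≤r n (ℕ.m⊔n≤o⇒m≤o L (M ℕ.⊔ N) q)))
  in *-monoˡ-≤-slack {seq x n} {seq y n} {seq r n} {B} {η} {ε} 0≤rₙ
       (subst (ℚ._≤ B) (ℚ.0≤p⇒∣p∣≡p 0≤rₙ) (r≤B n (ℕ.m⊔n≤o⇒m≤o M N q′)))
       (ℚ.<⇒≤ 0<η) Bη≡ε (x≤y+η n (ℕ.m⊔n≤o⇒n≤o M N q′))

-- The gap `c` is a lower bound for `r` uniform in `n`. Using the hypothesis with slack `c * ε`,
-- which is eventually at most `r ε` termwise, lets the positive rational `seq r n` be cancelled and
-- leaves slack `ε`.
*-cancelˡ-≤-pos : ∀ r {x y} → 0ℝ < r → r * x ≤ r * y → x ≤ y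
*-cancelˡ-≤-pos r {x} {y} (c , 0<c , c≤r) rx≤ry ε 0<ε =
  Eventually-map₂ (λ {n} p q → bound {n} (0+p≤q⇒p≤q c p) q) c≤r (rx≤ry (c ℚ.* ε) (0<p*q 0<c 0<ε))
  where
  open ℚ.≤-Reasoning
  bound : ∀ {n} → c ℚ.≤ seq r n →
          seq r n ℚ.* seq x n ℚ.≤ seq r n ℚ.* seq y n ℚ.+ c ℚ.* ε →
          seq x n ℚ.≤ seq y n ℚ.+ ε
  bound {n} c≤rₙ h = ℚ.*-cancelˡ-≤-pos (seq r n) {{ℚ.positive (ℚ.<-≤-trans 0<c c≤rₙ)}} (begin
    seq r n ℚ.* seq x n                      ≤⟨ h ⟩
    seq r n ℚ.* seq y n ℚ.+ c ℚ.* ε          ≤⟨ ℚ.+-monoʳ-≤ (seq r n ℚ.* seq y n)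
                                                  (ℚ.*-monoʳ-≤-nonNeg ε {{ℚ.nonNegative (ℚ.<⇒≤ 0<ε)}} c≤rₙ) ⟩
    seq r n ℚ.* seq y n ℚ.+ seq r n ℚ.* ε    ≡⟨ ℚ.*-distribˡ-+ (seq r n) (seq y n) ε ⟨
    seq r n ℚ.* (seq y n ℚ.+ ε)              ∎)

UBG-mono : ∀ {a b ℓ₁ ℓ₂ v e} (X : MetricSpace a ℓ₁) (Y : MetricSpace b ℓ₂) →
  (∀ (S : FiniteSubset X) → SimilarlyEmbedded X Y S) → UBG {v = v} {e = e} X ⊆ UBG Y
UBG-mono X Y embed {G} (δ , 0<δ , ρ , E⇔) = transport (embed S)
  where
  open Graph G using (V; enumeration)
  open Inverse enumeration using (to; from; strictlyInverseʳ)
  module X = MetricSpace X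
  module Y = MetricSpace Y
  open Membership X.setoid using (_∈_)

  S : FiniteSubset X
  S = tabulate (ρ ∘ from)

  point : V → Elements X S
  -- The entry of `S` at index `to u` is `ρ (from (to u))`. Only the membership proof is
  -- transported, so the first component stays `ρ u` and `scale` speaks directly of
  -- `X.d (ρ u) (ρ w)`.
  point u = ρ u , subst (λ w → ρ w ∈ S) (strictlyInverseʳ u) (Membershipₚ.∈-tabulate⁺ X.setoid (to u))

  transport : SimilarlyEmbedded X Y S → UBG Y G
  transport (r , 0<r , f , scale) = r * δ , *-pos {r} {δ} 0<r 0<δ , f ∘ point , λ u w u≢w →
    let open Equivalence (E⇔ u w u≢w) renaming (to to E⇒≤; from to ≤⇒E)
        dY = Y.d (f (point u)) (f (point w))
        dX = X.d (ρ u) (ρ w)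
        dY≃r*dX = scale (point u) (point w)
    in mk⇔
      -- As `dY ≃ r * dX`, comparing `dY` with `r * δ` is comparing `dX` with `δ`: monotonicity
      -- carries edges to short distances, cancellation brings short distances back to edges.
      (λ uw → ≤.trans {dY} {r * dX} {r * δ} (≤.reflexive {dY} {r * dX} dY≃r*dX)
                (*-monoˡ-≤-pos r {dX} {δ} 0<r (E⇒≤ uw)))
      (λ dY≤rδ → ≤⇒E (*-cancelˡ-≤-pos r {dX} {δ} 0<r
        (≤.trans {r * dX} {dY} {r * δ}
          (≤.reflexive {r * dX} {dY} (≤.Eq.sym {dY} {r * dX} dY≃r*dX)) dY≤rδ)))

corollary2p5 : ∀ {a b ℓ₁ ℓ₂ v e} (X : MetricSpace a ℓ₁) (Y : MetricSpace b ℓ₂) →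
    (∀ (S : FiniteSubset X) → SimilarlyEmbedded X Y S) →
    (∀ (T : FiniteSubset Y) → SimilarlyEmbedded Y X T) →
    UBG {v = v} {e = e} X ≐ UBG Y
corollary2p5 X Y X↪Y Y↪X =
  (λ {G} → UBG-mono X Y X↪Y {G}) , (λ {G} → UBG-mono Y X Y↪X {G})
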